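{- Let $\mathcal F\subseteq\omega^\omega$ and let $\mathcal I,\mathcal J$ be ideals on $\omega$ such that $\mathcal I$ is tall and $\mathcal I\not\le_{\mathcal F}\mathcal J\restriction A$ for all $A\notin\mathcal J$. Then: (1) $\mathfrak p(\mathcal J)\le\mathfrak{fip}(\mathcal I,\mathcal J,\mathcal F)$; (2) $\operatorname{add}^*(\mathcal I)\le\mathfrak{fip}(\mathcal I,\mathcal J,\mathcal F)$.
   Context: An ideal on a set $X$ is a family of subsets of $X$ closed under finite unions and subsets, containing all finite subsets of $X$ and not containing $X$; $\mathcal J^+$ is the family of subsets of $X$ not in $\mathcal J$. $\mathcal I$ on $\omega$ is tall if every infinite $A\subseteq\omega$ contains an infinite $B\in\mathcal I$. For $A\notin\mathcal J$, $\mathcal J\restriction A=\{B\cap A:B\in\mathcal J\}$ (an ideal on $A$), and $\mathcal I\le_{\mathcal F}\mathcal J\restriction A$ means that there is $f\in\mathcal F$ with $f^{ -1}[B]\cap A\in\mathcal J$ for every $B\in\mathcal I$ (functions in $\mathcal F$ are restricted to $A$). A nonempty family $\mathcal A\subseteq\mathcal P(\omega)$ has $\mathcal J^+$-FIP if $\bigcap F\in\mathcal J^+$ for each finite $F\subseteq\mathcal A$. A set $B\in\mathcal J^+$ is a $\mathcal J^+$-pseudointersection of $\mathcal A$ if $B\setminus A\in\mathcal J$ for each $A\in\mathcal A$. With $\mathfrak c=2^{\aleph_0}$: $\mathfrak p(\mathcal J)=\min(\{|\mathcal A|:\mathcal A$ has $\mathcal J^+$-FIP but has no $\mathcal J^+$-pseudointersection$\}\cup\{\mathfrak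 c^+\})$; $\operatorname{add}^*(\mathcal I)=\min\{|\mathcal A|:\mathcal A\subseteq\mathcal I$ and there is no $B\in\mathcal I$ with $A\setminus B$ finite for all $A\in\mathcal A\}$ (well defined for tall $\mathcal I$); $\mathfrak{fip}(\mathcal I,\mathcal J,\mathcal F)$ is the minimum of the set consisting of $\mathfrak c^+$ and all cardinals $|\mathcal A|$ such that $\mathcal A\subseteq\mathcal P(\omega)$ has $\mathcal J^+$-FIP and it is not true that for every $f\in\mathcal F$ there is $B\in\mathcal I$ such that $\mathcal A\cup\{f^{ -1}[B]\}$ has $\mathcal J^+$-FIP. -}

module Defs where

open import Axiom.ExcludedMiddle using (ExcludedMiddle)
open import Axiom.Extensionality.Propositional using (Extensionality)
open import Data.Bool using (Bool; true; false; T; _∧_; _∨_; not)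
open import Data.Bool.Properties using (T-∧; T-∨; T-irrelevant)
open import Data.Empty using (⊥-elim)
open import Data.List.Membership.Propositional using () renaming (_∈_ to _∈ˡ_)
open import Data.Nat using (ℕ)
open import Data.Product using (∃; ∃-syntax; _×_; _,_; proj₁; proj₂)
open import Data.Sum using (_⊎_; inj₁; inj₂; [_,_])
open import Data.Unit using (⊤; tt)
open import Function using (_∘_; const; case_of_)
open import Function.Bundles using (_↣_; mk↣; module Injection; module Equivalence)
open import Level using (0ℓ)
open import Relation.Binary.PropositionalEquality using (_≡_; refl; sym; trans; cong; subst)
open import Relation.Nullary using (¬_; yes; no)
open import Relation.Nullary.Decidable using (⌊_⌋; toWitness; fromWitness)

-- Subsets are Bool-valued characteristic functions: membership is then
-- proof-irrelevant, and function extensionality makes _≡_ on 𝒫 X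
-- extensional equality of sets.  Under excluded middle every predicate
-- is of this form (see compr).

𝒫 : Set → Set
𝒫 X = X → Bool

module _ {X : Set} where

  infix  4 _∈_ _∉_ _⊆_
  infixr 6 _∪_
  infixr 7 _∩_
  infixl 7 _∖_

  _∈_ _∉_ : X → 𝒫 X → Set
  x ∈ A = T (A x)
  x ∉ A = ¬ (x ∈ A)

  _⊆_ : 𝒫 X → 𝒫 X → Set
  A ⊆ B = ∀ x → x ∈ A → x ∈ B

  _∪_ _∩_ _∖_ : 𝒫 X → 𝒫 X → 𝒫 X
  (A ∪ B) x = A x ∨ B x
  (A ∩ B) x = A x ∧ B x
  (A ∖ B) x = A x ∧ not (B x)

  full : 𝒫 X
  full _ = true

  Finite Infinite : 𝒫 X → Set
  Finite A = ∃[ xs ] (∀ x → x ∈ A → x ∈ˡ xs)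
  Infinite A = ¬ Finite A

_⁻¹[_] : {X Y : Set} → (X → Y) → 𝒫 Y → 𝒫 X
f ⁻¹[ B ] = B ∘ f

-- A cardinal is represented by any set of that cardinality, so equality
-- of cardinals is ≤ᶜ in both directions.

Cardinal : Set₁
Cardinal = Set

infix 4 _≤ᶜ_ _<ᶜ_

_≤ᶜ_ _<ᶜ_ : Cardinal → Cardinal → Set
κ ≤ᶜ μ = κ ↣ μ
κ <ᶜ μ = (κ ≤ᶜ μ) × ¬ (μ ≤ᶜ κ)

∣_∣ : {X : Set} → 𝒫 X → Cardinal
∣ A ∣ = ∃[ x ] x ∈ A

𝔠 : Cardinal
𝔠 = 𝒫 ℕ

record Ideal (X : Set) : Set where
  field
    family   : 𝒫 (𝒫 X)
    ∪-closed : ∀ A B → A ∈ family → B ∈ family → A ∪ B ∈ family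
    ⊆-closed : ∀ A B → A ⊆ B → B ∈ family → A ∈ family
    finite   : ∀ A → Finite A → A ∈ family
    proper   : full ∉ family

open Ideal public using (family)

infix 4 _∈ᴵ_ _∈⁺_

_∈ᴵ_ _∈⁺_ : {X : Set} → 𝒫 X → Ideal X → Set
A ∈ᴵ 𝒥 = A ∈ family 𝒥
A ∈⁺ 𝒥 = A ∉ family 𝒥

Tall : Ideal ℕ → Set
Tall ℐ = ∀ A → Infinite A → ∃[ B ] (B ⊆ A × Infinite B × B ∈ᴵ ℐ)

infix 4 _≤[_]_↾_

_≤[_]_↾_ : Ideal ℕ → 𝒫 (ℕ → ℕ) → Ideal ℕ → 𝒫 ℕ → Set
ℐ ≤[ ℱ ] 𝒥 ↾ A = ∃[ f ] (f ∈ ℱ × (∀ B → B ∈ᴵ ℐ → f ⁻¹[ B ] ∩ A ∈ᴵ 𝒥))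

-- The classical metatheory.  Excluded middle is stated for all types in
-- Set, so together with function extensionality it also provides choice.

module Classical (em : ExcludedMiddle 0ℓ) (ext : Extensionality 0ℓ 0ℓ) where

  compr : {X : Set} → (X → Set) → 𝒫 X
  compr P x = ⌊ em {P x} ⌋

  syntax compr (λ x → P) = ｛ x ∣ P ｝

  module _ {X : Set} (P : X → Set) where

    ∈-compr⁺ : ∀ {x} → P x → x ∈ compr P
    ∈-compr⁺ = fromWitness

    ∈-compr⁻ : ∀ {x} → x ∈ compr P → P x
    ∈-compr⁻ = toWitness

  ｛_｝ : {X : Set} → X → 𝒫 X
  ｛ a ｝ = ｛ x ∣ x ≡ a ｝

  ⋂ : {X : Set} → 𝒫 (𝒫 X) → 𝒫 X
  ⋂ 𝒜 = ｛ x ∣ (∀ A → A ∈ 𝒜 → x ∈ A) ｝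

  ⋃ : {X : Set} → 𝒫 (𝒫 X) → 𝒫 X
  ⋃ 𝒜 = ｛ x ∣ (∃[ A ] (A ∈ 𝒜 × x ∈ A)) ｝

  module _ {X : Set} where

    ∈-｛｝⁺ : ∀ a {x : X} → x ≡ a → x ∈ ｛ a ｝
    ∈-｛｝⁺ a = ∈-compr⁺ (_≡ a)

    ∈-｛｝⁻ : ∀ a {x : X} → x ∈ ｛ a ｝ → x ≡ a
    ∈-｛｝⁻ a = ∈-compr⁻ (_≡ a)

    ∈-⋂⁺ : ∀ 𝒜 {x : X} → (∀ A → A ∈ 𝒜 → x ∈ A) → x ∈ ⋂ 𝒜
    ∈-⋂⁺ 𝒜 = ∈-compr⁺ λ x → ∀ A → A ∈ 𝒜 → x ∈ A

    ∈-⋂⁻ : ∀ 𝒜 {x : X} → x ∈ ⋂ 𝒜 → ∀ A → A ∈ 𝒜 → x ∈ A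
    ∈-⋂⁻ 𝒜 = ∈-compr⁻ λ x → ∀ A → A ∈ 𝒜 → x ∈ A

    ∈-⋃⁺ : ∀ 𝒜 {x : X} → ∃[ A ] (A ∈ 𝒜 × x ∈ A) → x ∈ ⋃ 𝒜
    ∈-⋃⁺ 𝒜 = ∈-compr⁺ λ x → ∃[ A ] (A ∈ 𝒜 × x ∈ A)

    ∈-⋃⁻ : ∀ 𝒜 {x : X} → x ∈ ⋃ 𝒜 → ∃[ A ] (A ∈ 𝒜 × x ∈ A)
    ∈-⋃⁻ 𝒜 = ∈-compr⁻ λ x → ∃[ A ] (A ∈ 𝒜 × x ∈ A)

  ⊆-antisym : {X : Set} {A B : 𝒫 X} → A ⊆ B → B ⊆ A → A ≡ B
  ⊆-antisym {A = A} {B} p q = ext λ x → eq (A x) (B x) (p x) (q x)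
    where
    eq : ∀ a b → (T a → T b) → (T b → T a) → a ≡ b
    eq true  true  _ _ = refl
    eq true  false f _ = ⊥-elim (f tt)
    eq false true  _ g = ⊥-elim (g tt)
    eq false false _ _ = refl

  by-contradiction : {P : Set} → ¬ ¬ P → P
  by-contradiction {P} ¬¬p with em {P}
  ... | yes p = p
  ... | no ¬p = ⊥-elim (¬¬p ¬p)

  ¬∀⇒∃¬ : {X : Set} {P : X → Set} → ¬ (∀ x → P x) → ∃[ x ] ¬ P x
  ¬∀⇒∃¬ ¬∀ = by-contradiction λ ¬∃ →
    ¬∀ λ x → by-contradiction λ ¬p → ¬∃ (x , ¬p)

  -- Every nonempty family of cardinals has a least member.  Among the
  -- sets of sections f : ∀ i → X i that are pairwise different at every
  -- index, a maximal one D (obtained by transfinitely adding sections)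
  -- has all of some X i as its values at i, so X i injects into each X j
  -- along D.

  private module Least {I : Set} (i₀ : I) (X : I → Set) where

    Π : Set
    Π = ∀ i → X i

    Hits : 𝒫 Π → (i : I) → X i → Set
    Hits D i x = ∃[ f ] (f ∈ D × f i ≡ x)

    Fresh : 𝒫 Π → Π → Set
    Fresh D g = ∀ i → ¬ Hits D i (g i)

    -- At most one section is added.
    next : 𝒫 Π → 𝒫 Π
    next D with em {∃ (Fresh D)}
    ... | yes (g , _) = D ∪ ｛ g ｝
    ... | no  _       = D

    ⊆-next : ∀ D → D ⊆ next D
    ⊆-next D x x∈D with em {∃ (Fresh D)}
    ... | yes _ = Equivalence.from T-∨ (inj₁ x∈D)
    ... | no  _ = x∈D

    data Tower : 𝒫 Π → Set where
      step : ∀ {D} → Tower D → Tower (next D)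
      sup  : (K : 𝒫 (𝒫 Π)) → (∀ D → D ∈ K → Tower D) → Tower (⋃ K)

    compare : ∀ {D E} → Tower D → Tower E → (next D ⊆ E) ⊎ (E ⊆ D)
    compare {D} {E} s (sup K t) with em {∀ A → A ∈ K → A ⊆ D}
    ... | yes all = inj₂ λ x x∈⋃ →
      case ∈-⋃⁻ K x∈⋃ of λ (A , A∈K , x∈A) → all A A∈K x x∈A
    ... | no ¬all with ¬∀⇒∃¬ ¬all
    ...   | A , ¬A with em {A ∈ K}
    ...     | no A∉K = ⊥-elim (¬A (⊥-elim ∘ A∉K))
    ...     | yes A∈K with compare s (t A A∈K)
    ...       | inj₁ p = inj₁ λ x x∈ → ∈-⋃⁺ K (A , A∈K , p x x∈)
    ...       | inj₂ p = ⊥-elim (¬A (const p))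
    compare {D} s (step {E} t) with compare s t
    ... | inj₁ p = inj₁ λ x x∈ → ⊆-next E x (p x x∈)
    ... | inj₂ p with compare t s
    ...   | inj₁ q = inj₂ q
    ...   | inj₂ q with ⊆-antisym {A = D} {E} q p
    ...     | refl = inj₁ λ _ x∈ → x∈

    Separated : 𝒫 Π → Set
    Separated D = ∀ f g → f ∈ D → g ∈ D → ∀ i → f i ≡ g i → f ≡ g

    separated : ∀ {D} → Tower D → Separated D
    separated (sup K t) f g f∈ g∈ with ∈-⋃⁻ K f∈ | ∈-⋃⁻ K g∈
    ... | A , A∈K , f∈A | B , B∈K , g∈B with compare (t A A∈K) (t B B∈K)
    ...   | inj₁ p = separated (t B B∈K) f g (p f (⊆-next A f f∈A)) g∈B
    ...   | inj₂ p = separated (t A A∈K) f g f∈A (p g g∈B)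
    separated (step {D} t) f g f∈ g∈ with em {∃ (Fresh D)}
    ... | no _ = separated t f g f∈ g∈
    ... | yes (h , fresh) with Equivalence.to T-∨ f∈ | Equivalence.to T-∨ g∈
    ...   | inj₁ f∈D | inj₁ g∈D = separated t f g f∈D g∈D
    ...   | inj₁ f∈D | inj₂ g≡h = λ i eq → ⊥-elim (fresh i
              (f , f∈D , trans eq (cong (λ k → k i) (∈-｛｝⁻ h g≡h))))
    ...   | inj₂ f≡h | inj₁ g∈D = λ i eq → ⊥-elim (fresh i
              (g , g∈D , trans (sym eq) (cong (λ k → k i) (∈-｛｝⁻ h f≡h))))
    ...   | inj₂ f≡h | inj₂ g≡h = λ _ _ → trans (∈-｛｝⁻ h f≡h) (sym (∈-｛｝⁻ h g≡h))

    W : 𝒫 Π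
    W = ⋃ ｛ D ∣ Tower D ｝

    W-tower : Tower W
    W-tower = sup ｛ D ∣ Tower D ｝ λ _ → ∈-compr⁻ Tower

    next-fresh : ∀ D → ∃ (Fresh D) → ∃[ g ] (Fresh D g × g ∈ next D)
    next-fresh D ∃fresh with em {∃ (Fresh D)}
    ... | yes (g , fresh) = g , fresh , Equivalence.from (T-∨ {D g}) (inj₂ (∈-｛｝⁺ g refl))
    ... | no  ¬fresh      = ⊥-elim (¬fresh ∃fresh)

    no-fresh : ¬ ∃ (Fresh W)
    no-fresh ∃fresh with next-fresh W ∃fresh
    ... | g , fresh , g∈next = fresh i₀ (g , g∈W , refl)
      where
      g∈W : g ∈ W
      g∈W = ∈-⋃⁺ ｛ D ∣ Tower D ｝ (next W , ∈-compr⁺ Tower (step W-tower) , g∈next)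

    covered : ∃[ i ] (∀ x → Hits W i x)
    covered = by-contradiction λ ¬cov →
      let missed : ∀ i → ∃[ x ] ¬ Hits W i x
          missed i = ¬∀⇒∃¬ λ all → ¬cov (i , all)
      in no-fresh ((λ i → proj₁ (missed i)) , λ i → proj₂ (missed i))

    least : ∃[ i ] (∀ j → X i ≤ᶜ X j)
    least with covered
    ... | i , hit = i , λ j → mk↣ {to = λ x → proj₁ (hit x) j} λ {x} {y} eq →
      let (f , f∈ , fx) = hit x
          (g , g∈ , gy) = hit y
      in trans (sym fx) (trans (cong (λ k → k i)
           (separated W-tower f g f∈ g∈ j eq)) gy)

  abstract
    argmin : {I : Set} → I → (I → Cardinal) → I
    argmin i₀ X = proj₁ (Least.least i₀ X)

    argmin-≤ : {I : Set} (i₀ : I) (X : I → Cardinal) →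
               ∀ j → X (argmin i₀ X) ≤ᶜ X j
    argmin-≤ i₀ X = proj₂ (Least.least i₀ X)

  -- min i₀ X is the minimum of {X i : i ∈ I}; the first argument only
  -- witnesses that this set is nonempty.

  min : {I : Set} → I → (I → Cardinal) → Cardinal
  min i₀ X = X (argmin i₀ X)

  -- min {∣A∣ : Φ A}, again with a witness of nonemptiness

  sizes : {X : Set} (Φ : 𝒫 X → Set) → ∃ Φ → Cardinal
  sizes Φ (A , _) = ∣ A ∣

  min-size : {X : Set} (Φ : 𝒫 X → Set) → ∃ Φ → Cardinal
  min-size Φ w = min w (sizes Φ)

  abstract
    cantor : ∀ κ → κ <ᶜ ∣ full {𝒫 κ} ∣
    cantor κ = mk↣ {to = λ x → ｛ x ｝ , tt} singleton-injective , diagonal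
      where
      singleton-injective : ∀ {x y} → _≡_ {A = ∣ full {𝒫 κ} ∣} (｛ x ｝ , tt) (｛ y ｝ , tt) → x ≡ y
      singleton-injective {x} {y} eq =
        ∈-｛｝⁻ y (subst (x ∈_) (cong proj₁ eq) (∈-｛｝⁺ x refl))

      diagonal : ¬ (∣ full {𝒫 κ} ∣ ≤ᶜ κ)
      diagonal inj = R∉ (∈-compr⁺ Q (R , refl , R∉))
        where
        to : 𝒫 κ → κ
        to A = Injection.to inj (A , tt)

        Q : κ → Set
        Q x = ∃[ A ] (x ≡ to A × x ∉ A)

        R : 𝒫 κ
        R = compr Q

        R∉ : to R ∉ R
        R∉ R∈ with ∈-compr⁻ Q R∈
        ... | A , eq , ∉A = ∉A (subst (λ B → to R ∈ B)
                                  (cong proj₁ (Injection.injective inj eq)) R∈)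

  -- Since κ < 2^κ, the least cardinal above κ is the minimum of the
  -- cardinals above κ of subsets of 𝒫 κ.

  _⁺ : Cardinal → Cardinal
  κ ⁺ = min-size (λ S → κ <ᶜ ∣ S ∣) (full {𝒫 κ} , cantor κ)

  <ᶜ-⁺ : ∀ κ → κ <ᶜ κ ⁺
  <ᶜ-⁺ κ = proj₂ (argmin (full {𝒫 κ} , cantor κ) (sizes (λ S → κ <ᶜ ∣ S ∣)))

  ≤ᶜ-trans : ∀ {κ μ ν} → κ ≤ᶜ μ → μ ≤ᶜ ν → κ ≤ᶜ ν
  ≤ᶜ-trans f g = mk↣ {to = Injection.to g ∘ Injection.to f}
    (Injection.injective f ∘ Injection.injective g)

  ≤ᶜ-total : ∀ κ μ → (κ ≤ᶜ μ) ⊎ (μ ≤ᶜ κ)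
  ≤ᶜ-total κ μ = go (argmin true X) (argmin-≤ true X)
    where
    X : Bool → Cardinal
    X true  = κ
    X false = μ

    go : ∀ b → (∀ c → X b ≤ᶜ X c) → (κ ≤ᶜ μ) ⊎ (μ ≤ᶜ κ)
    go true  h = inj₁ (h false)
    go false h = inj₂ (h true)

  ∣∣-≡ : {X : Set} {A : 𝒫 X} {p q : ∣ A ∣} → proj₁ p ≡ proj₁ q → p ≡ q
  ∣∣-≡ {p = x , s} {.x , t} refl = cong (x ,_) (T-irrelevant s t)

  ⁺≤ : ∀ κ ((S , _) : ∃[ S ] (κ <ᶜ ∣ S ∣)) → κ ⁺ ≤ᶜ ∣ S ∣
  ⁺≤ κ = argmin-≤ (full {𝒫 κ} , cantor κ) (sizes (λ S → κ <ᶜ ∣ S ∣))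

  ⁺-least : ∀ {κ μ} → κ <ᶜ μ → κ ⁺ ≤ᶜ μ
  ⁺-least {κ} {μ} (κ≤μ , μ≰κ) with ≤ᶜ-total ∣ full {𝒫 κ} ∣ μ
  ... | inj₁ p = ≤ᶜ-trans (⁺≤ κ (full , cantor κ)) p
  ... | inj₂ f = ≤ᶜ-trans (⁺≤ κ (S , κ<S)) S≤μ
    where
    to : μ → 𝒫 κ
    to = proj₁ ∘ Injection.to f

    Q : 𝒫 κ → Set
    Q A = ∃[ m ] to m ≡ A

    S : 𝒫 (𝒫 κ)
    S = compr Q

    μ≤S : μ ≤ᶜ ∣ S ∣
    μ≤S = mk↣ {to = λ m → to m , ∈-compr⁺ Q (m , refl)} λ eq →
      Injection.injective f (∣∣-≡ (cong proj₁ eq))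

    S≤μ : ∣ S ∣ ≤ᶜ μ
    S≤μ = mk↣ {to = λ (A , A∈S) → proj₁ (∈-compr⁻ Q A∈S)}
      λ {(A , A∈S)} {(B , B∈S)} eq → ∣∣-≡ (trans (sym (proj₂ (∈-compr⁻ Q A∈S)))
        (trans (cong to eq) (proj₂ (∈-compr⁻ Q B∈S))))

    κ<S : κ <ᶜ ∣ S ∣
    κ<S = ≤ᶜ-trans κ≤μ μ≤S , λ S≤κ → μ≰κ (≤ᶜ-trans μ≤S S≤κ)

  -- min ({∣𝒜∣ : Φ 𝒜} ∪ {𝔠⁺})

  min-or-𝔠⁺ : (𝒫 (𝒫 ℕ) → Set) → Cardinal
  min-or-𝔠⁺ Φ = min {∃ Φ ⊎ ⊤} (inj₂ tt) [ sizes Φ , const (𝔠 ⁺) ]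

  HasFIP : Ideal ℕ → 𝒫 (𝒫 ℕ) → Set
  HasFIP 𝒥 𝒜 = (∃[ A ] A ∈ 𝒜) × (∀ F → F ⊆ 𝒜 → Finite F → ⋂ F ∈⁺ 𝒥)

  IsPseudointersection : Ideal ℕ → 𝒫 (𝒫 ℕ) → 𝒫 ℕ → Set
  IsPseudointersection 𝒥 𝒜 B = B ∈⁺ 𝒥 × (∀ A → A ∈ 𝒜 → B ∖ A ∈ᴵ 𝒥)

  𝔭 : Ideal ℕ → Cardinal
  𝔭 𝒥 = min-or-𝔠⁺ λ 𝒜 → HasFIP 𝒥 𝒜 × ¬ (∃[ B ] IsPseudointersection 𝒥 𝒜 B)

  𝔣𝔦𝔭 : Ideal ℕ → Ideal ℕ → 𝒫 (ℕ → ℕ) → Cardinal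
  𝔣𝔦𝔭 ℐ 𝒥 ℱ = min-or-𝔠⁺ λ 𝒜 →
    HasFIP 𝒥 𝒜 ×
    ¬ (∀ f → f ∈ ℱ → ∃[ B ] (B ∈ᴵ ℐ × HasFIP 𝒥 (𝒜 ∪ ｛ f ⁻¹[ B ] ｝)))

  Unbounded* : Ideal ℕ → 𝒫 (𝒫 ℕ) → Set
  Unbounded* ℐ 𝒜 =
    𝒜 ⊆ family ℐ × ¬ (∃[ B ] (B ∈ᴵ ℐ × (∀ A → A ∈ 𝒜 → Finite (A ∖ B))))

  abstract
    tall⇒unbounded* : (ℐ : Ideal ℕ) → Tall ℐ → Unbounded* ℐ (family ℐ)
    tall⇒unbounded* ℐ tall = (λ _ A∈ → A∈) , λ (B , B∈ , bound) →
      let co-infinite : Infinite (full ∖ B)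
          co-infinite fin = Ideal.proper ℐ (Ideal.⊆-closed ℐ full (B ∪ (full ∖ B)) (split B)
            (Ideal.∪-closed ℐ B (full ∖ B) B∈ (Ideal.finite ℐ (full ∖ B) fin)))
          (C , C⊆ , C-inf , C∈) = tall (full ∖ B) co-infinite
          (xs , C∖B⊆xs) = bound C C∈
      in C-inf (xs , λ x x∈C → C∖B⊆xs x (Equivalence.from (T-∧ {C x}) (x∈C , C⊆ x x∈C)))
      where
      split : (B : 𝒫 ℕ) → full ⊆ B ∪ (full ∖ B)
      split B x _ with B x
      ... | true  = tt
      ... | false = tt

  add* : (ℐ : Ideal ℕ) → Tall ℐ → Cardinal
  add* ℐ tall = min-size (Unbounded* ℐ) (family ℐ , tall⇒unbounded* ℐ tall)

{-# OPTIONS --safe #-}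
module Submission where

-- Let 𝒜 have the 𝒥⁺-FIP and let f ∈ ℱ.  In both parts a set B ∈ ℐ is
-- wanted such that f⁻¹[B] meets every finite intersection M of members
-- of 𝒜 in a 𝒥-positive set.  The hypothesis on ℐ and 𝒥 says that each
-- positive set A has its own B ∈ ℐ with f⁻¹[B] ∩ A positive
-- (positive-preimage); the point is to find one B for all M.
--
-- (1) If 𝒜 has a pseudointersection P, the B belonging to P serves,
-- since P is contained in every M up to a set in 𝒥.  Hence an 𝒜 that
-- is counted in 𝔣𝔦𝔭 is also counted in 𝔭.
--
-- (2) Suppose that |𝒜| < add*(ℐ).  Each M is first given a B_M ∈ ℐ that
-- is robust: f⁻¹[C] ∩ M is positive for every C that almost contains
-- B_M.  Then any C ∈ ℐ almost containing all B_M is as wanted.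
--
-- Robust sets exist unless some singleton ｛ k ｝ already is a B for all
-- M (robust-witness).  Let K be the set of those k whose fibre f⁻¹[k] is
-- positive on M.  If K is infinite, tallness gives an infinite B_M ∈ ℐ
-- inside K, and every C that almost contains B_M contains a point of K.
-- If K is finite, finitely many further members of 𝒜 shrink M to an M′
-- on which all fibres are in 𝒥; then for B_M with f⁻¹[B_M] ∩ M′ positive,
-- changing B_M at finitely many points changes f⁻¹[B_M] ∩ M′ only by a
-- set in 𝒥.
--
-- It remains to bound the B_M, which are indexed by finite sequences in
-- 𝒜.  Instead of computing the number of these sequences, bound the B_M
-- for sequences of length n by induction on n, using |𝒜| many sets at
-- each step, and then bound the resulting countably many bounds
-- (lists-bounded).  The last step needs 𝒜 to be infinite; a finite 𝒜 has
-- a smallest M, and its B_M alone is enough.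

open import Axiom.ExcludedMiddle using (ExcludedMiddle)
open import Axiom.Extensionality.Propositional using (Extensionality)
open import Data.Bool using (true; false)
open import Data.Bool.Properties using (T-∧; T-∨)
open import Data.Empty using (⊥-elim)
open import Data.List using (List; []; _∷_; _++_; map; length)
open import Data.List.Membership.Propositional using () renaming (_∈_ to _∈ˡ_)
open import Data.List.Membership.Propositional.Properties using (∈-++⁺ˡ; ∈-++⁺ʳ; ∈-map⁺)
open import Data.List.Relation.Unary.All using (All; []; _∷_; lookup; tabulate)
open import Data.List.Relation.Unary.All.Properties using (++⁻)
open import Data.List.Relation.Unary.Any using (here; there)
open import Data.Nat using (ℕ; zero; suc; _<′_; <′-base; ≤′-step)
open import Data.Nat.Properties using (<-cmp; <⇒<′)
open import Data.Product using (∃; ∃-syntax; _×_; _,_; proj₁; proj₂)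
open import Data.Sum using (_⊎_; inj₁; inj₂; [_,_])
open import Data.Unit using (tt)
open import Function using (_∘_; const)
open import Function.Bundles using (mk↣; module Equivalence)
open import Level using (0ℓ)
open import Relation.Binary.Definitions using (tri<; tri≈; tri>)
open import Relation.Binary.PropositionalEquality using (_≡_; refl; sym; trans; cong; subst)
open import Relation.Nullary using (¬_; yes; no)
open import Defs

-- Boolean operations on subsets, almost inclusion and positive sets

module _ {X : Set} where

  ∈-∩⁺ : ∀ (A B : 𝒫 X) {x} → x ∈ A → x ∈ B → x ∈ A ∩ B
  ∈-∩⁺ A B {x} x∈A x∈B = Equivalence.from (T-∧ {A x} {B x}) (x∈A , x∈B)

  ∈-∩⁻ : ∀ (A B : 𝒫 X) {x} → x ∈ A ∩ B → x ∈ A × x ∈ B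
  ∈-∩⁻ A B {x} = Equivalence.to (T-∧ {A x} {B x})

  ∈-∪⁺ : ∀ (A B : 𝒫 X) {x} → x ∈ A ⊎ x ∈ B → x ∈ A ∪ B
  ∈-∪⁺ A B {x} = Equivalence.from (T-∨ {A x} {B x})

  ∈-∪⁻ : ∀ (A B : 𝒫 X) {x} → x ∈ A ∪ B → x ∈ A ⊎ x ∈ B
  ∈-∪⁻ A B {x} = Equivalence.to (T-∨ {A x} {B x})

  ∈-∖⁺ : ∀ (A B : 𝒫 X) {x} → x ∈ A → x ∉ B → x ∈ A ∖ B
  ∈-∖⁺ A B {x} x∈A x∉B with A x | B x
  ... | true | true  = x∉B tt
  ... | true | false = tt

  ∈-∖⁻ : ∀ (A B : 𝒫 X) {x} → x ∈ A ∖ B → x ∈ A × x ∉ B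
  ∈-∖⁻ A B {x} x∈ with A x | B x
  ... | true | false = tt , λ ()

  ∈-split : ∀ (B : 𝒫 X) x → x ∈ B ⊎ x ∉ B
  ∈-split B x with B x
  ... | true  = inj₁ tt
  ... | false = inj₂ λ ()

  infix 4 _⊆*_

  _⊆*_ : 𝒫 X → 𝒫 X → Set
  A ⊆* B = Finite (A ∖ B)

  ⊆*-refl : ∀ A → A ⊆* A
  ⊆*-refl A = [] , λ x x∈ → let (x∈A , x∉A) = ∈-∖⁻ A A x∈ in ⊥-elim (x∉A x∈A)

  ⊆*-trans : ∀ A B C → A ⊆* B → B ⊆* C → A ⊆* C
  ⊆*-trans A B C (xs , A∖B⊆xs) (ys , B∖C⊆ys) = xs ++ ys , λ x x∈ →
    let (x∈A , x∉C) = ∈-∖⁻ A C x∈ in cover x x∈A x∉C (∈-split B x)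
    where
    cover : ∀ x → x ∈ A → x ∉ C → x ∈ B ⊎ x ∉ B → x ∈ˡ xs ++ ys
    cover x x∈A x∉C (inj₁ x∈B) = ∈-++⁺ʳ xs (B∖C⊆ys x (∈-∖⁺ B C x∈B x∉C))
    cover x x∈A x∉C (inj₂ x∉B) = ∈-++⁺ˡ (A∖B⊆xs x (∈-∖⁺ A B x∈A x∉B))

  ⊆-∈⁺ : ∀ (𝒥 : Ideal X) A B → A ⊆ B → A ∈⁺ 𝒥 → B ∈⁺ 𝒥
  ⊆-∈⁺ 𝒥 A B A⊆B A∈⁺ B∈ = A∈⁺ (Ideal.⊆-closed 𝒥 A B A⊆B B∈)

  -- Positivity survives the removal of a small part.
  ∈⁺-remove : ∀ (𝒥 : Ideal X) A S B → A ⊆ S ∪ B → S ∈ᴵ 𝒥 → A ∈⁺ 𝒥 → B ∈⁺ 𝒥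
  ∈⁺-remove 𝒥 A S B A⊆S∪B S∈ A∈⁺ B∈ =
    ⊆-∈⁺ 𝒥 A (S ∪ B) A⊆S∪B A∈⁺ (Ideal.∪-closed 𝒥 S B S∈ B∈)

module Proof (em : ExcludedMiddle 0ℓ) (ext : Extensionality 0ℓ 0ℓ) where

  open Classical em ext

  finite-｛｝ : ∀ {X : Set} (a : X) → Finite ｛ a ｝
  finite-｛｝ a = a ∷ [] , λ x x∈ → here (∈-｛｝⁻ a x∈)

  -- Cardinals

  -- Repeatedly picking a point outside the finite set of earlier picks
  -- never ends.
  infinite⇒ℕ≤ᶜ : ∀ {X : Set} → ¬ (∃[ xs ] (∀ (x : X) → x ∈ˡ xs)) → ℕ ≤ᶜ X
  infinite⇒ℕ≤ᶜ {X} inf = mk↣ {to = pick ∘ picks} injective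
    where
    fresh : ∀ xs → ∃[ x ] ¬ (x ∈ˡ xs)
    fresh xs = ¬∀⇒∃¬ λ all → inf (xs , all)

    pick : List X → X
    pick xs = proj₁ (fresh xs)

    picks : ℕ → List X
    picks zero    = []
    picks (suc n) = pick (picks n) ∷ picks n

    earlier : ∀ {m n} → m <′ n → pick (picks m) ∈ˡ picks n
    earlier <′-base       = here refl
    earlier (≤′-step m<n) = there (earlier m<n)

    distinct : ∀ {m n} → m <′ n → ¬ (pick (picks m) ≡ pick (picks n))
    distinct {m} {n} m<n eq =
      proj₂ (fresh (picks n)) (subst (_∈ˡ picks n) eq (earlier m<n))

    injective : ∀ {m n} → pick (picks m) ≡ pick (picks n) → m ≡ n
    injective {m} {n} eq with <-cmp m n
    ... | tri< m<n _ _ = ⊥-elim (distinct (<⇒<′ m<n) eq)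
    ... | tri≈ _ m≡n _ = m≡n
    ... | tri> _ _ n<m = ⊥-elim (distinct (<⇒<′ n<m) (sym eq))

  range : ∀ {X Y : Set} → (X → Y) → 𝒫 Y
  range g = ｛ y ∣ (∃[ x ] g x ≡ y) ｝

  ∈-range⁺ : ∀ {X Y : Set} (g : X → Y) x → g x ∈ range g
  ∈-range⁺ g x = ∈-compr⁺ (λ y → ∃[ x ] g x ≡ y) (x , refl)

  ∈-range⁻ : ∀ {X Y : Set} (g : X → Y) {y} → y ∈ range g → ∃[ x ] g x ≡ y
  ∈-range⁻ g = ∈-compr⁻ (λ y → ∃[ x ] g x ≡ y)

  ∣range∣≤ : ∀ {X Y : Set} (g : X → Y) → ∣ range g ∣ ≤ᶜ X
  ∣range∣≤ g = mk↣ {to = λ (y , y∈) → proj₁ (∈-range⁻ g y∈)}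
    λ {(y , y∈)} {(z , z∈)} eq → ∣∣-≡ (trans (sym (proj₂ (∈-range⁻ g y∈)))
      (trans (cong g eq) (proj₂ (∈-range⁻ g z∈))))

  ≤-min-or-𝔠⁺ : ∀ κ Φ → κ ≤ᶜ 𝔠 ⁺ → (∀ 𝒜 → Φ 𝒜 → κ ≤ᶜ ∣ 𝒜 ∣) → κ ≤ᶜ min-or-𝔠⁺ Φ
  ≤-min-or-𝔠⁺ κ Φ κ≤𝔠⁺ κ≤ = every (argmin (inj₂ tt) [ sizes Φ , const (𝔠 ⁺) ])
    where
    every : ∀ i → κ ≤ᶜ [ sizes Φ , const (𝔠 ⁺) ] i
    every (inj₁ (𝒜 , φ)) = κ≤ 𝒜 φ
    every (inj₂ _)       = κ≤𝔠⁺

  min-or-𝔠⁺≤ : ∀ Φ 𝒜 → Φ 𝒜 → min-or-𝔠⁺ Φ ≤ᶜ ∣ 𝒜 ∣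
  min-or-𝔠⁺≤ Φ 𝒜 φ = argmin-≤ (inj₂ tt) [ sizes Φ , const (𝔠 ⁺) ] (inj₁ (𝒜 , φ))

  min-or-𝔠⁺≤𝔠⁺ : ∀ Φ → min-or-𝔠⁺ Φ ≤ᶜ 𝔠 ⁺
  min-or-𝔠⁺≤𝔠⁺ Φ = argmin-≤ (inj₂ tt) [ sizes Φ , const (𝔠 ⁺) ] (inj₂ tt)

  -- Bounding families of fewer than add* sets

  module _ (ℐ : Ideal ℕ) (tall : Tall ℐ) where

    Bounded : {Y : Set} → (Y → 𝒫 ℕ) → Set
    Bounded g = ∃[ B ] (B ∈ᴵ ℐ × (∀ y → g y ⊆* B))

    add*≤ : ∀ 𝒜 → Unbounded* ℐ 𝒜 → add* ℐ tall ≤ᶜ ∣ 𝒜 ∣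
    add*≤ 𝒜 unbounded = argmin-≤ (family ℐ , tall⇒unbounded* ℐ tall)
      (sizes (Unbounded* ℐ)) (𝒜 , unbounded)

    add*≤𝔠⁺ : add* ℐ tall ≤ᶜ 𝔠 ⁺
    add*≤𝔠⁺ = ≤ᶜ-trans (add*≤ (family ℐ) (tall⇒unbounded* ℐ tall))
      (≤ᶜ-trans (mk↣ {to = proj₁} ∣∣-≡) (proj₁ (<ᶜ-⁺ 𝔠)))

    -- An unbounded family has at least add* members, and its index set at
    -- least as many as the family.
    few-bounded : ∀ {Y : Set} → ¬ (add* ℐ tall ≤ᶜ Y) →
                  (g : Y → 𝒫 ℕ) → (∀ y → g y ∈ᴵ ℐ) → Bounded g
    few-bounded few g g∈ = by-contradiction λ unbounded →
      few (≤ᶜ-trans (add*≤ (range g) (range⊆ , λ (B , B∈ , bound) →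
        unbounded (B , B∈ , λ y → bound (g y) (∈-range⁺ g y)))) (∣range∣≤ g))
      where
      range⊆ : range g ⊆ family ℐ
      range⊆ A A∈ = let (y , gy≡A) = ∈-range⁻ g A∈ in subst (_∈ᴵ ℐ) gy≡A (g∈ y)

    -- Almost inclusion is transitive, so a bound of bounds is a bound.  The
    -- sequences y ∷ l of length n + 1 are therefore bounded in two stages,
    -- first over l for fixed y, then over y; the bounds for all lengths
    -- form a countable family, which is small because ℕ ≤ᶜ Y.
    lists-bounded : ∀ {Y : Set} → ¬ (add* ℐ tall ≤ᶜ Y) → ℕ ≤ᶜ Y →
                    (g : List Y → 𝒫 ℕ) → (∀ l → g l ∈ᴵ ℐ) → Bounded g
    lists-bounded {Y} few ℕ≤Y g g∈ =
      let bₙ = λ n → of-length n g g∈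
          (B , B∈ , bound) = few-bounded (few ∘ λ add*≤ℕ → ≤ᶜ-trans add*≤ℕ ℕ≤Y)
            (proj₁ ∘ bₙ) (proj₁ ∘ proj₂ ∘ bₙ)
      in B , B∈ , λ l → ⊆*-trans (g l) (proj₁ (bₙ (length l))) B
           (proj₂ (proj₂ (bₙ (length l))) l refl) (bound (length l))
      where
      of-length : ∀ n (g : List Y → 𝒫 ℕ) → (∀ l → g l ∈ᴵ ℐ) →
                  ∃[ B ] (B ∈ᴵ ℐ × (∀ l → length l ≡ n → g l ⊆* B))
      of-length zero    g g∈ = g [] , g∈ [] , λ { [] refl → ⊆*-refl (g []) }
      of-length (suc n) g g∈ =
        let b = λ y → of-length n (g ∘ (y ∷_)) (g∈ ∘ (y ∷_))
            (B , B∈ , bound) = few-bounded few (proj₁ ∘ b) (proj₁ ∘ proj₂ ∘ b)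
        in B , B∈ , λ { (y ∷ l) refl →
             ⊆*-trans (g (y ∷ l)) (proj₁ (b y)) B (proj₂ (proj₂ (b y)) l refl) (bound y) }

  -- Finite intersections of an indexed family

  module _ {Y : Set} (S : Y → 𝒫 ℕ) where

    InAll : List Y → ℕ → Set
    InAll l x = All (λ y → x ∈ S y) l

    meet : List Y → 𝒫 ℕ
    meet l = compr (InAll l)

    ∈-meet⁺ : ∀ l {x} → InAll l x → x ∈ meet l
    ∈-meet⁺ l = ∈-compr⁺ (InAll l)

    ∈-meet⁻ : ∀ l {x} → x ∈ meet l → InAll l x
    ∈-meet⁻ l = ∈-compr⁻ (InAll l)

    meet-++ : ∀ l m → meet (l ++ m) ⊆ meet l ∩ meet m
    meet-++ l m x x∈ = let (x∈l , x∈m) = ++⁻ l (∈-meet⁻ (l ++ m) x∈)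
      in ∈-∩⁺ (meet l) (meet m) (∈-meet⁺ l x∈l) (∈-meet⁺ m x∈m)

  FIP⇒meet∈⁺ : ∀ 𝒥 𝒜 → HasFIP 𝒥 𝒜 → ∀ l → meet {∣ 𝒜 ∣} proj₁ l ∈⁺ 𝒥
  FIP⇒meet∈⁺ 𝒥 𝒜 (_ , fip) l =
    ⊆-∈⁺ 𝒥 (⋂ F) (meet proj₁ l)
      (λ x x∈ → ∈-meet⁺ proj₁ l (tabulate λ {(A , _)} A∈l →
        ∈-⋂⁻ F x∈ A (∈-compr⁺ Listed (∈-map⁺ proj₁ A∈l))))
      (fip F F⊆𝒜 (map proj₁ l , λ A → ∈-compr⁻ Listed))
    where
    Listed : 𝒫 ℕ → Set
    Listed A = A ∈ˡ map proj₁ l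

    F : 𝒫 (𝒫 ℕ)
    F = compr Listed

    listed⊆𝒜 : ∀ (m : List ∣ 𝒜 ∣) A → A ∈ˡ map proj₁ m → A ∈ 𝒜
    listed⊆𝒜 ((_ , A∈𝒜) ∷ m) _ (here refl) = A∈𝒜
    listed⊆𝒜 (_ ∷ m)         A (there A∈)  = listed⊆𝒜 m A A∈

    F⊆𝒜 : F ⊆ 𝒜
    F⊆𝒜 A A∈F = listed⊆𝒜 l A (∈-compr⁻ Listed A∈F)

  -- Dropping from a list the sets outside 𝒜 leaves a list that can be met.
  select : ∀ (𝒜 : 𝒫 (𝒫 ℕ)) As →
           ∃[ l ] (∀ A → A ∈ 𝒜 → A ∈ˡ As → meet {∣ 𝒜 ∣} proj₁ l ⊆ A)
  select 𝒜 [] = [] , λ _ _ ()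
  select 𝒜 (A ∷ As) with select 𝒜 As | em {A ∈ 𝒜}
  ... | l , meet⊆ | no A∉𝒜 = l , λ where
    _ A∈𝒜 (here refl) → ⊥-elim (A∉𝒜 A∈𝒜)
    B B∈𝒜 (there B∈)  → meet⊆ B B∈𝒜 B∈
  ... | l , meet⊆ | yes A∈𝒜 = (A , A∈𝒜) ∷ l , λ where
    _ _ (here refl) x x∈ → lookup (∈-meet⁻ proj₁ ((A , A∈𝒜) ∷ l) x∈) (here refl)
    B B∈𝒜 (there B∈) x x∈ → meet⊆ B B∈𝒜 B∈ x
      (∈-meet⁺ proj₁ l (tabulate (lookup (∈-meet⁻ proj₁ ((A , A∈𝒜) ∷ l) x∈) ∘ there)))

  meet∈⁺⇒FIP : ∀ 𝒥 𝒜 → (∃[ A ] A ∈ 𝒜) → ∀ C →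
               (∀ l → C ∩ meet {∣ 𝒜 ∣} proj₁ l ∈⁺ 𝒥) → HasFIP 𝒥 (𝒜 ∪ ｛ C ｝)
  meet∈⁺⇒FIP 𝒥 𝒜 (A₀ , A₀∈) C pos =
    (A₀ , ∈-∪⁺ 𝒜 ｛ C ｝ (inj₁ A₀∈)) , λ F F⊆ (As , F⊆As) →
      let (l , meet⊆) = select 𝒜 As
          below : ∀ x → x ∈ C ∩ meet proj₁ l → ∀ A → A ∈ F → x ∈ A
          below x x∈ A A∈F = let (x∈C , x∈l) = ∈-∩⁻ C (meet proj₁ l) x∈ in
            member x∈C (λ A∈𝒜 → meet⊆ A A∈𝒜 (F⊆As A A∈F) x x∈l)
              (∈-∪⁻ 𝒜 ｛ C ｝ (F⊆ A A∈F))
      in ⊆-∈⁺ 𝒥 (C ∩ meet proj₁ l) (⋂ F) (λ x x∈ → ∈-⋂⁺ F (below x x∈)) (pos l)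
    where
    member : ∀ {x A} → x ∈ C → (A ∈ 𝒜 → x ∈ A) → A ∈ 𝒜 ⊎ A ∈ ｛ C ｝ → x ∈ A
    member         x∈C x∈A (inj₁ A∈𝒜) = x∈A A∈𝒜
    member {x} {A} x∈C x∈A (inj₂ A≡C) = subst (x ∈_) (sym (∈-｛｝⁻ C A≡C)) x∈C

  -- Preimages under f

  positive-preimage : ∀ ℱ ℐ 𝒥 A → ¬ (ℐ ≤[ ℱ ] 𝒥 ↾ A) → ∀ f → f ∈ ℱ →
                      ∃[ B ] (B ∈ᴵ ℐ × f ⁻¹[ B ] ∩ A ∈⁺ 𝒥)
  positive-preimage ℱ ℐ 𝒥 A ≰ f f∈ = by-contradiction λ none →
    ≰ (f , f∈ , λ B B∈ → by-contradiction λ pos → none (B , B∈ , pos))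

  ⁻¹-mono : ∀ (f : ℕ → ℕ) B C M N → B ⊆ C → M ⊆ N → f ⁻¹[ B ] ∩ M ⊆ f ⁻¹[ C ] ∩ N
  ⁻¹-mono f B C M N B⊆C M⊆N x x∈ = let (fx∈B , x∈M) = ∈-∩⁻ (f ⁻¹[ B ]) M x∈
    in ∈-∩⁺ (f ⁻¹[ C ]) N (B⊆C (f x) fx∈B) (M⊆N x x∈M)

  -- P leaves S y₁ ∩ … ∩ S yₙ only where it leaves one of the S yᵢ.
  ∖-meet∈ᴵ : ∀ (𝒥 : Ideal ℕ) {Y : Set} (S : Y → 𝒫 ℕ) P → (∀ y → P ∖ S y ∈ᴵ 𝒥) →
             ∀ l → P ∖ meet S l ∈ᴵ 𝒥
  ∖-meet∈ᴵ 𝒥 S P small [] = Ideal.finite 𝒥 (P ∖ meet S []) ([] , λ x x∈ →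
    ⊥-elim (proj₂ (∈-∖⁻ P (meet S []) x∈) (∈-meet⁺ S [] [])))
  ∖-meet∈ᴵ 𝒥 S P small (y ∷ l) =
    Ideal.⊆-closed 𝒥 (P ∖ meet S (y ∷ l)) ((P ∖ S y) ∪ (P ∖ meet S l)) cover
      (Ideal.∪-closed 𝒥 (P ∖ S y) (P ∖ meet S l) (small y) (∖-meet∈ᴵ 𝒥 S P small l))
    where
    cover : P ∖ meet S (y ∷ l) ⊆ (P ∖ S y) ∪ (P ∖ meet S l)
    cover x x∈ with ∈-∖⁻ P (meet S (y ∷ l)) x∈ | ∈-split (S y) x
    ... | x∈P , x∉ | inj₂ x∉S = ∈-∪⁺ (P ∖ S y) (P ∖ meet S l) (inj₁ (∈-∖⁺ P (S y) x∈P x∉S))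
    ... | x∈P , x∉ | inj₁ x∈S = ∈-∪⁺ (P ∖ S y) (P ∖ meet S l)
      (inj₂ (∈-∖⁺ P (meet S l) x∈P λ x∈l → x∉ (∈-meet⁺ S (y ∷ l) (x∈S ∷ ∈-meet⁻ S l x∈l))))

  finite-preimage∈ᴵ : ∀ (𝒥 : Ideal ℕ) (f : ℕ → ℕ) M D → Finite D →
                      (∀ k → k ∈ D → f ⁻¹[ ｛ k ｝ ] ∩ M ∈ᴵ 𝒥) → f ⁻¹[ D ] ∩ M ∈ᴵ 𝒥
  finite-preimage∈ᴵ 𝒥 f M D (ks , D⊆ks) = go ks D D⊆ks
    where
    go : ∀ ks D → (∀ k → k ∈ D → k ∈ˡ ks) →
         (∀ k → k ∈ D → f ⁻¹[ ｛ k ｝ ] ∩ M ∈ᴵ 𝒥) → f ⁻¹[ D ] ∩ M ∈ᴵ 𝒥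
    go [] D D⊆ks small = Ideal.finite 𝒥 (f ⁻¹[ D ] ∩ M) ([] , λ x x∈ →
      ⊥-elim (case-[] (D⊆ks (f x) (proj₁ (∈-∩⁻ (f ⁻¹[ D ]) M x∈)))))
      where
      case-[] : ∀ {k : ℕ} → ¬ (k ∈ˡ [])
      case-[] ()
    go (k ∷ ks) D D⊆ks small with ∈-split D k
    ... | inj₂ k∉D = go ks D (λ j j∈D → tail j j∈D (D⊆ks j j∈D)) small
      where
      tail : ∀ j → j ∈ D → j ∈ˡ k ∷ ks → j ∈ˡ ks
      tail _ j∈D (here refl) = ⊥-elim (k∉D j∈D)
      tail _ _   (there j∈)  = j∈
    ... | inj₁ k∈D =
      Ideal.⊆-closed 𝒥 (f ⁻¹[ D ] ∩ M) (Fibre ∪ Rest) cover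
        (Ideal.∪-closed 𝒥 Fibre Rest (small k k∈D)
          (go ks D′ (λ j j∈ → tail j (∈-∖⁻ D ｛ k ｝ j∈) (D⊆ks j (proj₁ (∈-∖⁻ D ｛ k ｝ j∈))))
            λ j j∈ → small j (proj₁ (∈-∖⁻ D ｛ k ｝ j∈))))
      where
      D′ Fibre Rest : 𝒫 ℕ
      D′    = D ∖ ｛ k ｝
      Fibre = f ⁻¹[ ｛ k ｝ ] ∩ M
      Rest  = f ⁻¹[ D′ ] ∩ M

      tail : ∀ j → j ∈ D × j ∉ ｛ k ｝ → j ∈ˡ k ∷ ks → j ∈ˡ ks
      tail _ (_ , j≢k) (here j≡k) = ⊥-elim (j≢k (∈-｛｝⁺ k j≡k))
      tail _ _         (there j∈) = j∈

      cover : f ⁻¹[ D ] ∩ M ⊆ Fibre ∪ Rest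
      cover x x∈ with ∈-∩⁻ (f ⁻¹[ D ]) M x∈ | ∈-split ｛ k ｝ (f x)
      ... | fx∈D , x∈M | inj₁ fx≡k =
        ∈-∪⁺ Fibre Rest (inj₁ (∈-∩⁺ (f ⁻¹[ ｛ k ｝ ]) M fx≡k x∈M))
      ... | fx∈D , x∈M | inj₂ fx≢k =
        ∈-∪⁺ Fibre Rest (inj₂ (∈-∩⁺ (f ⁻¹[ D′ ]) M (∈-∖⁺ D ｛ k ｝ fx∈D fx≢k) x∈M))

  -- One set of ℐ for all meets

  module _ (ℐ 𝒥 : Ideal ℕ) (tall : Tall ℐ) (f : ℕ → ℕ)
           (preimage : ∀ A → A ∈⁺ 𝒥 → ∃[ B ] (B ∈ᴵ ℐ × f ⁻¹[ B ] ∩ A ∈⁺ 𝒥))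
           {Y : Set} (S : Y → 𝒫 ℕ) (pos : ∀ l → meet S l ∈⁺ 𝒥) where

    Works : 𝒫 ℕ → Set
    Works B = ∀ l → f ⁻¹[ B ] ∩ meet S l ∈⁺ 𝒥

    -- Robustness is what allows B to be replaced by a common bound of many
    -- such sets.
    Robust : 𝒫 ℕ → 𝒫 ℕ → Set
    Robust M B = ∀ C → B ⊆* C → f ⁻¹[ C ] ∩ M ∈⁺ 𝒥

    module _ (small-fibres : ∀ k → ∃[ l ] f ⁻¹[ ｛ k ｝ ] ∩ meet S l ∈ᴵ 𝒥) where

      shrink : ∀ k m l → meet S m ⊆ meet S l →
               f ⁻¹[ ｛ k ｝ ] ∩ meet S l ∈ᴵ 𝒥 → f ⁻¹[ ｛ k ｝ ] ∩ meet S m ∈ᴵ 𝒥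
      shrink k m l m⊆l = Ideal.⊆-closed 𝒥
        (f ⁻¹[ ｛ k ｝ ] ∩ meet S m) (f ⁻¹[ ｛ k ｝ ] ∩ meet S l)
        (⁻¹-mono f ｛ k ｝ ｛ k ｝ (meet S m) (meet S l) (λ _ j∈ → j∈) m⊆l)

      all-small : ∀ ks → ∃[ m ] (∀ k → k ∈ˡ ks → f ⁻¹[ ｛ k ｝ ] ∩ meet S m ∈ᴵ 𝒥)
      all-small [] = [] , λ _ ()
      all-small (k ∷ ks) with small-fibres k | all-small ks
      ... | l , small | m , smalls = l ++ m , λ
        { _ (here refl) → shrink k (l ++ m) l
            (λ x → proj₁ ∘ ∈-∩⁻ (meet S l) (meet S m) ∘ meet-++ S l m x) small
        ; j (there j∈)  → shrink j (l ++ m) m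
            (λ x → proj₂ ∘ ∈-∩⁻ (meet S l) (meet S m) ∘ meet-++ S l m x) (smalls j j∈)
        }

      -- If infinitely many fibres are positive on the meet, B consists of
      -- such points, one of which lies in C.  Otherwise the meet shrinks
      -- until every fibre is small, and then f⁻¹[B ∖ C] is negligible.
      robust-witness : ∀ l → ∃[ B ] (B ∈ᴵ ℐ × Robust (meet S l) B)
      robust-witness l with em {Finite ｛ k ∣ f ⁻¹[ ｛ k ｝ ] ∩ meet S l ∈⁺ 𝒥 ｝}
      ... | no K-infinite = B , B∈ , robust
        where
        Positive : ℕ → Set
        Positive k = f ⁻¹[ ｛ k ｝ ] ∩ meet S l ∈⁺ 𝒥

        chosen : ∃[ B ] (B ⊆ compr Positive × Infinite B × B ∈ᴵ ℐ)
        chosen = tall (compr Positive) K-infinite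

        B : 𝒫 ℕ
        B = proj₁ chosen

        B∈ : B ∈ᴵ ℐ
        B∈ = proj₂ (proj₂ (proj₂ chosen))

        robust : Robust (meet S l) B
        robust C (xs , B∖C⊆xs) C-small = proj₁ (proj₂ (proj₂ chosen))
          (xs , λ k k∈B → B∖C⊆xs k (∈-∖⁺ B C k∈B λ k∈C →
            ⊆-∈⁺ 𝒥 (f ⁻¹[ ｛ k ｝ ] ∩ meet S l) (f ⁻¹[ C ] ∩ meet S l)
              (⁻¹-mono f ｛ k ｝ C (meet S l) (meet S l)
                (λ j j≡k → subst (_∈ C) (sym (∈-｛｝⁻ k j≡k)) k∈C) (λ _ x∈ → x∈))
              (∈-compr⁻ Positive (proj₁ (proj₂ chosen) k k∈B)) C-small))
      ... | yes (ks , K⊆ks) = B , B∈ , robust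
        where
        m : List Y
        m = proj₁ (all-small ks)

        M : 𝒫 ℕ
        M = meet S (l ++ m)

        M⊆l : M ⊆ meet S l
        M⊆l x = proj₁ ∘ ∈-∩⁻ (meet S l) (meet S m) ∘ meet-++ S l m x

        M⊆m : M ⊆ meet S m
        M⊆m x = proj₂ ∘ ∈-∩⁻ (meet S l) (meet S m) ∘ meet-++ S l m x

        fibre-small : ∀ k → f ⁻¹[ ｛ k ｝ ] ∩ M ∈ᴵ 𝒥
        fibre-small k with em {f ⁻¹[ ｛ k ｝ ] ∩ meet S l ∈ᴵ 𝒥}
        ... | yes small    = shrink k (l ++ m) l M⊆l small
        ... | no  positive = shrink k (l ++ m) m M⊆m
          (proj₂ (all-small ks) k (K⊆ks k
            (∈-compr⁺ (λ k → f ⁻¹[ ｛ k ｝ ] ∩ meet S l ∈⁺ 𝒥) positive)))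

        B : 𝒫 ℕ
        B = proj₁ (preimage M (pos (l ++ m)))

        B∈ : B ∈ᴵ ℐ
        B∈ = proj₁ (proj₂ (preimage M (pos (l ++ m))))

        robust : Robust (meet S l) B
        robust C B⊆*C = ∈⁺-remove 𝒥 (f ⁻¹[ B ] ∩ M) Exception (f ⁻¹[ C ] ∩ meet S l) cover
          (finite-preimage∈ᴵ 𝒥 f M (B ∖ C) B⊆*C λ k _ → fibre-small k)
          (proj₂ (proj₂ (preimage M (pos (l ++ m)))))
          where
          Exception : 𝒫 ℕ
          Exception = f ⁻¹[ B ∖ C ] ∩ M

          cover : f ⁻¹[ B ] ∩ M ⊆ Exception ∪ (f ⁻¹[ C ] ∩ meet S l)
          cover x x∈ with ∈-∩⁻ (f ⁻¹[ B ]) M x∈ | ∈-split C (f x)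
          ... | _ , x∈M | inj₁ fx∈C = ∈-∪⁺ Exception (f ⁻¹[ C ] ∩ meet S l)
            (inj₂ (∈-∩⁺ (f ⁻¹[ C ]) (meet S l) fx∈C (M⊆l x x∈M)))
          ... | fx∈B , x∈M | inj₂ fx∉C = ∈-∪⁺ Exception (f ⁻¹[ C ] ∩ meet S l)
            (inj₁ (∈-∩⁺ (f ⁻¹[ B ∖ C ]) M (∈-∖⁺ B C fx∈B fx∉C) x∈M))

      small-fibres⇒works : ¬ (add* ℐ tall ≤ᶜ Y) → ∃[ B ] (B ∈ᴵ ℐ × Works B)
      small-fibres⇒works few with em {∃[ ys ] (∀ (y : Y) → y ∈ˡ ys)}
      ... | no infinite =
        let (B , B∈ , bound) = lists-bounded ℐ tall few (infinite⇒ℕ≤ᶜ infinite)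
              (proj₁ ∘ robust-witness) (proj₁ ∘ proj₂ ∘ robust-witness)
        in B , B∈ , λ l → proj₂ (proj₂ (robust-witness l)) B (bound l)
      -- The meet over all indices is the least one.
      ... | yes (ys , all) =
        let (B , B∈ , robust) = robust-witness ys
        in B , B∈ , λ l → ⊆-∈⁺ 𝒥 (f ⁻¹[ B ] ∩ meet S ys) (f ⁻¹[ B ] ∩ meet S l)
             (⁻¹-mono f B B (meet S ys) (meet S l) (λ _ x∈ → x∈) λ x x∈ →
               ∈-meet⁺ S l (tabulate λ {y} _ → lookup (∈-meet⁻ S ys x∈) (all y)))
             (robust B (⊆*-refl B))

    -- If ｛ k ｝ works for no k, then each fibre is small on some meet.
    few⇒works : ¬ (add* ℐ tall ≤ᶜ Y) → ∃[ B ] (B ∈ᴵ ℐ × Works B)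
    few⇒works few with em {∃[ k ] Works ｛ k ｝}
    ... | yes (k , works) = ｛ k ｝ , Ideal.finite ℐ ｛ k ｝ (finite-｛｝ k) , works
    ... | no  none        = small-fibres⇒works (λ k → by-contradiction λ large →
      none (k , λ l small → large (l , small))) few

  -- Comparison of the cardinals

  module _ (ℱ : 𝒫 (ℕ → ℕ)) (ℐ 𝒥 : Ideal ℕ)
           (≰ : ∀ A → A ∈⁺ 𝒥 → ¬ (ℐ ≤[ ℱ ] 𝒥 ↾ A)) where

    pseudointersection⇒FIP : ∀ 𝒜 → HasFIP 𝒥 𝒜 → ∃ (IsPseudointersection 𝒥 𝒜) →
      ∀ f → f ∈ ℱ → ∃[ B ] (B ∈ᴵ ℐ × HasFIP 𝒥 (𝒜 ∪ ｛ f ⁻¹[ B ] ｝))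
    pseudointersection⇒FIP 𝒜 fip (P , P∈⁺ , P∖A∈) f f∈ =
      let (B , B∈ , B-pos) = positive-preimage ℱ ℐ 𝒥 P (≰ P P∈⁺) f f∈
      in B , B∈ , meet∈⁺⇒FIP 𝒥 𝒜 (proj₁ fip) (f ⁻¹[ B ]) λ l →
           ∈⁺-remove 𝒥 (f ⁻¹[ B ] ∩ P) (P ∖ meet proj₁ l) (f ⁻¹[ B ] ∩ meet proj₁ l)
             (cover B (meet proj₁ l))
             (∖-meet∈ᴵ 𝒥 proj₁ P (λ (A , A∈) → P∖A∈ A A∈) l) B-pos
      where
      cover : ∀ B M → f ⁻¹[ B ] ∩ P ⊆ (P ∖ M) ∪ (f ⁻¹[ B ] ∩ M)
      cover B M x x∈ with ∈-∩⁻ (f ⁻¹[ B ]) P x∈ | ∈-split M x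
      ... | fx∈B , x∈P | inj₁ x∈M =
        ∈-∪⁺ (P ∖ M) (f ⁻¹[ B ] ∩ M) (inj₂ (∈-∩⁺ (f ⁻¹[ B ]) M fx∈B x∈M))
      ... | fx∈B , x∈P | inj₂ x∉M =
        ∈-∪⁺ (P ∖ M) (f ⁻¹[ B ] ∩ M) (inj₁ (∈-∖⁺ P M x∈P x∉M))

    𝔭≤𝔣𝔦𝔭 : 𝔭 𝒥 ≤ᶜ 𝔣𝔦𝔭 ℐ 𝒥 ℱ
    𝔭≤𝔣𝔦𝔭 = ≤-min-or-𝔠⁺ (𝔭 𝒥) _ (min-or-𝔠⁺≤𝔠⁺ _) λ 𝒜 (fip , bad) →
      min-or-𝔠⁺≤ _ 𝒜 (fip , λ pseudo → bad (pseudointersection⇒FIP 𝒜 fip pseudo))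

    add*≤𝔣𝔦𝔭 : (tall : Tall ℐ) → add* ℐ tall ≤ᶜ 𝔣𝔦𝔭 ℐ 𝒥 ℱ
    add*≤𝔣𝔦𝔭 tall = ≤-min-or-𝔠⁺ (add* ℐ tall) _ (add*≤𝔠⁺ ℐ tall) λ 𝒜 (fip , bad) →
      by-contradiction λ few → bad λ f f∈ →
        let (B , B∈ , works) = few⇒works ℐ 𝒥 tall f
              (λ A A∈⁺ → positive-preimage ℱ ℐ 𝒥 A (≰ A A∈⁺) f f∈)
              proj₁ (FIP⇒meet∈⁺ 𝒥 𝒜 fip) few
        in B , B∈ , meet∈⁺⇒FIP 𝒥 𝒜 (proj₁ fip) (f ⁻¹[ B ]) works

theorem4p1 : (em : ExcludedMiddle 0ℓ) (ext : Extensionality 0ℓ 0ℓ) →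
    let open Classical em ext in
    (ℱ : 𝒫 (ℕ → ℕ)) (ℐ 𝒥 : Ideal ℕ) (tall : Tall ℐ) →
    (∀ A → A ∈⁺ 𝒥 → ¬ (ℐ ≤[ ℱ ] 𝒥 ↾ A)) →
    (𝔭 𝒥 ≤ᶜ 𝔣𝔦𝔭 ℐ 𝒥 ℱ) × (add* ℐ tall ≤ᶜ 𝔣𝔦𝔭 ℐ 𝒥 ℱ)
theorem4p1 em ext ℱ ℐ 𝒥 tall ≰ = 𝔭≤𝔣𝔦𝔭 ℱ ℐ 𝒥 ≰ , add*≤𝔣𝔦𝔭 ℱ ℐ 𝒥 ≰ tall
  where open Proof em ext
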